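{- Let $t,n$ be rational integers and let $\omega$ be a real quadratic irrational with $\omega^2-t\omega+n=0$. Let $h\ge 1$ and suppose that the continued fraction expansion of $\omega$ commences $$\omega=[\,A,\,a_1,\,a_2,\,\ldots,\,a_h,\,(\omega+P_{h+1})/Q_{h+1}\,],$$ where $A$ is an integer, $a_1,\ldots,a_h$ are positive integers, and the complete quotient following $a_h$ is $(\omega+P_{h+1})/Q_{h+1}$ with $P_{h+1},Q_{h+1}$ integers. Set $P=P_{h+1}$, $Q=Q_{h+1}$, and define integers $p,p',q,q'$ by $$\begin{pmatrix} a_1 & 1\\ 1& 0\end{pmatrix}\begin{pmatrix} a_2 & 1\\ 1& 0\end{pmatrix}\cdots\begin{pmatrix} a_h & 1\\ 1& 0\end{pmatrix}=\begin{pmatrix} p & p'\\ q& q'\end{pmatrix}.$$ Then both $$p(P^2+tP+n)+p'Q(A+P)=-q'Q$$ and $$p(A^2-tA+n)+q(A+P)=-q'Q.$$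
   Context: Continued fraction notation: $[a_0]=a_0$ and $[a_0,a_1,\ldots,a_m]=a_0+1/[a_1,\ldots,a_m]$, where the last entry may be any real number (a complete quotient). The complete quotients $\alpha_{j}$ of $\alpha=[a_0,a_1,a_2,\ldots]$ are defined by $\alpha=[a_0,a_1,\ldots,a_{j-1},\alpha_{j}]$. For a quadratic irrational integer $\omega$, every complete quotient has the form $(\omega+P_j)/Q_j$ with $P_j,Q_j$ rational integers, $Q_j\neq 0$. -}

module Defs where

open import Data.Integer as ℤ using (ℤ)
open import Data.List using (List; []; _∷_)
open import Data.Nat as ℕ using (ℕ; _⊔_)
open import Data.Nat.Coprimality using (sym; 1-coprimeTo)
import Data.Nat.Properties as ℕₚ
open import Data.Product using (∃-syntax; _×_; _,_; proj₁; proj₂)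
open import Data.Rational as ℚ using (ℚ; 0ℚ; 1ℚ; ½; mkℚ)
import Data.Rational.Properties as ℚₚ
open import Data.Rational.Solver using (module +-*-Solver)
open import Data.Vec using (Vec; []; _∷_)
open import Relation.Binary.PropositionalEquality
  using (_≡_; refl; cong; subst; module ≡-Reasoning) renaming (sym to ≡-sym)
open import Relation.Nullary using (¬_)

IsCauchy : (ℕ → ℚ) → Set
IsCauchy x = ∀ ε → 0ℚ ℚ.< ε →
  ∃[ N ] (∀ m n → N ℕ.≤ m → N ℕ.≤ n → ℚ.∣ x m ℚ.- x n ∣ ℚ.< ε)

-- Equality of reals is the relation _≈_ below, not _≡_.
record ℝ : Set where
  constructor mkℝ
  field
    seq    : ℕ → ℚ
    cauchy : IsCauchy seq

open ℝ public

infix 4 _≈_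

_≈_ : ℝ → ℝ → Set
x ≈ y = ∀ ε → 0ℚ ℚ.< ε →
  ∃[ N ] (∀ n → N ℕ.≤ n → ℚ.∣ seq x n ℚ.- seq y n ∣ ℚ.< ε)

half-pos : ∀ {ε} → 0ℚ ℚ.< ε → 0ℚ ℚ.< ε ℚ.* ½
half-pos {ε} ε>0 = ℚₚ.*-monoˡ-<-pos ½ ε>0

half+half : ∀ ε → ε ℚ.* ½ ℚ.+ ε ℚ.* ½ ≡ ε
half+half ε = begin
  ε ℚ.* ½ ℚ.+ ε ℚ.* ½ ≡⟨ ℚₚ.*-distribˡ-+ ε ½ ½ ⟨
  ε ℚ.* 1ℚ            ≡⟨ ℚₚ.*-identityʳ ε ⟩
  ε                   ∎
  where open ≡-Reasoning

const-cauchy : ∀ r → IsCauchy (λ _ → r)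
const-cauchy r ε ε>0 =
  0 , λ _ _ _ _ → subst (λ d → ℚ.∣ d ∣ ℚ.< ε) (≡-sym (ℚₚ.+-inverseʳ r)) ε>0

+-cauchy : ∀ {x y} → IsCauchy x → IsCauchy y → IsCauchy (λ n → x n ℚ.+ y n)
+-cauchy {x} {y} cx cy ε ε>0 =
  let M , hx = cx (ε ℚ.* ½) (half-pos ε>0)
      N , hy = cy (ε ℚ.* ½) (half-pos ε>0)
  in M ⊔ N , λ m n p q → begin-strict
    ℚ.∣ (x m ℚ.+ y m) ℚ.- (x n ℚ.+ y n) ∣
      ≡⟨ cong ℚ.∣_∣ (rearrange (x m) (y m) (x n) (y n)) ⟩
    ℚ.∣ (x m ℚ.- x n) ℚ.+ (y m ℚ.- y n) ∣
      ≤⟨ ℚₚ.∣p+q∣≤∣p∣+∣q∣ (x m ℚ.- x n) (y m ℚ.- y n) ⟩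
    ℚ.∣ x m ℚ.- x n ∣ ℚ.+ ℚ.∣ y m ℚ.- y n ∣
      <⟨ ℚₚ.+-mono-< (hx m n (ℕₚ.m⊔n≤o⇒m≤o M N p) (ℕₚ.m⊔n≤o⇒m≤o M N q))
                     (hy m n (ℕₚ.m⊔n≤o⇒n≤o M N p) (ℕₚ.m⊔n≤o⇒n≤o M N q)) ⟩
    ε ℚ.* ½ ℚ.+ ε ℚ.* ½
      ≡⟨ half+half ε ⟩
    ε ∎
  where
  open ℚₚ.≤-Reasoning
  rearrange : ∀ a b c d → (a ℚ.+ b) ℚ.- (c ℚ.+ d) ≡ (a ℚ.- c) ℚ.+ (b ℚ.- d)
  rearrange = solve 4 (λ a b c d → (a :+ b) :- (c :+ d) := (a :- c) :+ (b :- d)) refl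
    where open +-*-Solver

neg-cauchy : ∀ {x} → IsCauchy x → IsCauchy (λ n → ℚ.- x n)
neg-cauchy {x} cx ε ε>0 =
  let N , hx = cx ε ε>0
  in N , λ m n p q → begin-strict
    ℚ.∣ ℚ.- x m ℚ.- ℚ.- x n ∣ ≡⟨ cong ℚ.∣_∣ (ℚₚ.neg-distrib-+ (x m) (ℚ.- x n)) ⟨
    ℚ.∣ ℚ.- (x m ℚ.- x n) ∣   ≡⟨ ℚₚ.∣-p∣≡∣p∣ (x m ℚ.- x n) ⟩
    ℚ.∣ x m ℚ.- x n ∣         <⟨ hx m n p q ⟩
    ε                         ∎
  where open ℚₚ.≤-Reasoning

bounded : ∀ {x} → IsCauchy x →
  ∃[ B ] (0ℚ ℚ.< B × (∃[ N ] (∀ n → N ℕ.≤ n → ℚ.∣ x n ∣ ℚ.< B)))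
bounded {x} cx =
  let N , hx = cx 1ℚ (ℚₚ.positive⁻¹ 1ℚ)
  in 1ℚ ℚ.+ ℚ.∣ x N ∣ ,
     ℚₚ.+-mono-<-≤ (ℚₚ.positive⁻¹ 1ℚ) (ℚₚ.0≤∣p∣ (x N)) ,
     N , λ n p → begin-strict
       ℚ.∣ x n ∣                         ≡⟨ cong ℚ.∣_∣ (split (x n) (x N)) ⟩
       ℚ.∣ (x n ℚ.- x N) ℚ.+ x N ∣       ≤⟨ ℚₚ.∣p+q∣≤∣p∣+∣q∣ (x n ℚ.- x N) (x N) ⟩
       ℚ.∣ x n ℚ.- x N ∣ ℚ.+ ℚ.∣ x N ∣   <⟨ ℚₚ.+-monoˡ-< ℚ.∣ x N ∣ (hx n N p ℕₚ.≤-refl) ⟩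
       1ℚ ℚ.+ ℚ.∣ x N ∣                  ∎
  where
  open ℚₚ.≤-Reasoning
  split : ∀ a b → a ≡ (a ℚ.- b) ℚ.+ b
  split = solve 2 (λ a b → a := (a :- b) :+ b) refl
    where open +-*-Solver

-- Given B > 0 and ε > 0, a δ > 0 with a * d < ε whenever a < B and d < δ.
scale : ∀ B ε → 0ℚ ℚ.< B → 0ℚ ℚ.< ε →
  ∃[ δ ] (0ℚ ℚ.< δ × (∀ a d → a ℚ.< B → ℚ.∣ d ∣ ℚ.< δ → a ℚ.* ℚ.∣ d ∣ ℚ.< ε))
scale B ε B>0 ε>0 = δ , δ>0 , bound
  where
  instance
    B-pos : ℚ.Positive B
    B-pos = ℚ.positive B>0
    B-nonZero : ℚ.NonZero B
    B-nonZero = ℚₚ.pos⇒nonZero B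
    ε-pos : ℚ.Positive ε
    ε-pos = ℚ.positive ε>0
    1/B-pos : ℚ.Positive (ℚ.1/ B)
    1/B-pos = ℚₚ.1/pos⇒pos B
  δ : ℚ
  δ = ℚ.1/ B ℚ.* ε
  δ>0 : 0ℚ ℚ.< δ
  δ>0 = ℚₚ.positive⁻¹ δ {{ℚₚ.pos*pos⇒pos (ℚ.1/ B) ε}}
  open ℚₚ.≤-Reasoning
  bound : ∀ a d → a ℚ.< B → ℚ.∣ d ∣ ℚ.< δ → a ℚ.* ℚ.∣ d ∣ ℚ.< ε
  bound a d a<B d<δ = begin-strict
    a ℚ.* ℚ.∣ d ∣           ≤⟨ ℚₚ.*-monoʳ-≤-nonNeg ℚ.∣ d ∣ {{ℚₚ.∣-∣-nonNeg d}} (ℚₚ.<⇒≤ a<B) ⟩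
    B ℚ.* ℚ.∣ d ∣           <⟨ ℚₚ.*-monoʳ-<-pos B d<δ ⟩
    B ℚ.* (ℚ.1/ B ℚ.* ε)    ≡⟨ ℚₚ.*-assoc B (ℚ.1/ B) ε ⟨
    (B ℚ.* ℚ.1/ B) ℚ.* ε    ≡⟨ cong (ℚ._* ε) (ℚₚ.*-inverseʳ B) ⟩
    1ℚ ℚ.* ε                ≡⟨ ℚₚ.*-identityˡ ε ⟩
    ε                       ∎

*-cauchy : ∀ {x y} → IsCauchy x → IsCauchy y → IsCauchy (λ n → x n ℚ.* y n)
*-cauchy {x} {y} cx cy ε ε>0 =
  let Bx , Bx>0 , K , bx = bounded cx
      By , By>0 , L , by = bounded cy
      δx , δx>0 , sx = scale By (ε ℚ.* ½) By>0 (half-pos ε>0)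
      δy , δy>0 , sy = scale Bx (ε ℚ.* ½) Bx>0 (half-pos ε>0)
      M , hx = cx δx δx>0
      N , hy = cy δy δy>0
  in (K ⊔ L) ⊔ (M ⊔ N) , λ m n p q →
    let p₁ = both K L (M ⊔ N) p
        q₁ = both K L (M ⊔ N) q
        p₂ = ℕₚ.m⊔n≤o⇒n≤o (K ⊔ L) (M ⊔ N) p
        q₂ = ℕₚ.m⊔n≤o⇒n≤o (K ⊔ L) (M ⊔ N) q
        dx = x m ℚ.- x n
        dy = y m ℚ.- y n
    in begin-strict
      ℚ.∣ x m ℚ.* y m ℚ.- x n ℚ.* y n ∣
        ≡⟨ cong ℚ.∣_∣ (rearrange (x m) (y m) (x n) (y n)) ⟩
      ℚ.∣ x m ℚ.* dy ℚ.+ y n ℚ.* dx ∣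
        ≤⟨ ℚₚ.∣p+q∣≤∣p∣+∣q∣ (x m ℚ.* dy) (y n ℚ.* dx) ⟩
      ℚ.∣ x m ℚ.* dy ∣ ℚ.+ ℚ.∣ y n ℚ.* dx ∣
        ≡⟨ cong (ℚ._+ ℚ.∣ y n ℚ.* dx ∣) (ℚₚ.∣p*q∣≡∣p∣*∣q∣ (x m) dy) ⟩
      ℚ.∣ x m ∣ ℚ.* ℚ.∣ dy ∣ ℚ.+ ℚ.∣ y n ℚ.* dx ∣
        ≡⟨ cong (ℚ.∣ x m ∣ ℚ.* ℚ.∣ dy ∣ ℚ.+_) (ℚₚ.∣p*q∣≡∣p∣*∣q∣ (y n) dx) ⟩
      ℚ.∣ x m ∣ ℚ.* ℚ.∣ dy ∣ ℚ.+ ℚ.∣ y n ∣ ℚ.* ℚ.∣ dx ∣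
        <⟨ ℚₚ.+-mono-<
             (sy ℚ.∣ x m ∣ dy (bx m (proj₁ p₁))
               (hy m n (ℕₚ.m⊔n≤o⇒n≤o M N p₂) (ℕₚ.m⊔n≤o⇒n≤o M N q₂)))
             (sx ℚ.∣ y n ∣ dx (by n (proj₂ q₁))
               (hx m n (ℕₚ.m⊔n≤o⇒m≤o M N p₂) (ℕₚ.m⊔n≤o⇒m≤o M N q₂))) ⟩
      ε ℚ.* ½ ℚ.+ ε ℚ.* ½
        ≡⟨ half+half ε ⟩
      ε ∎
  where
  open ℚₚ.≤-Reasoning
  both : ∀ K L R {o} → (K ⊔ L) ⊔ R ℕ.≤ o → K ℕ.≤ o × L ℕ.≤ o
  both K L R p = let p′ = ℕₚ.m⊔n≤o⇒m≤o (K ⊔ L) R p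
                 in ℕₚ.m⊔n≤o⇒m≤o K L p′ , ℕₚ.m⊔n≤o⇒n≤o K L p′
  rearrange : ∀ a b c d →
    a ℚ.* b ℚ.- c ℚ.* d ≡ a ℚ.* (b ℚ.- d) ℚ.+ d ℚ.* (a ℚ.- c)
  rearrange = solve 4
    (λ a b c d → a :* b :- c :* d := a :* (b :- d) :+ d :* (a :- c)) refl
    where open +-*-Solver

infixl 6 _+_ _-_
infixl 7 _*_

fromℚ : ℚ → ℝ
fromℚ r = mkℝ (λ _ → r) (const-cauchy r)

_+_ : ℝ → ℝ → ℝ
x + y = mkℝ (λ n → seq x n ℚ.+ seq y n)
            (+-cauchy {seq x} {seq y} (cauchy x) (cauchy y))

_-_ : ℝ → ℝ → ℝ
x - y = mkℝ (λ n → seq x n ℚ.- seq y n)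
            (+-cauchy {seq x} {λ n → ℚ.- seq y n} (cauchy x) (neg-cauchy {seq y} (cauchy y)))

_*_ : ℝ → ℝ → ℝ
x * y = mkℝ (λ n → seq x n ℚ.* seq y n)
            (*-cauchy {seq x} {seq y} (cauchy x) (cauchy y))

-- k / 1, built with the constructor so that NonZero (ℤ→ℚ k) reduces to NonZero k.
ℤ→ℚ : ℤ → ℚ
ℤ→ℚ k = mkℚ k 0 (sym (1-coprimeTo ℤ.∣ k ∣))

fromℤ : ℤ → ℝ
fromℤ k = fromℚ (ℤ→ℚ k)

infixl 7 _÷_

_÷_ : ℝ → (k : ℤ) .{{_ : ℤ.NonZero k}} → ℝ
x ÷ k = x * fromℚ (ℚ.1/ ℤ→ℚ k)

Irrational : ℝ → Set
Irrational x = ∀ r → ¬ (x ≈ fromℚ r)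

-- For apart-from-zero x the reciprocal is unique up to ≈; stating it as a
-- relation means that a reciprocal is only ever taken where it exists.
IsReciprocal : ℝ → ℝ → Set
IsReciprocal x y = x * y ≈ fromℤ ℤ.1ℤ

-- α ≈[ a₀ ∷ … ∷ aⱼ₋₁ ∷ [] ⨾ θ ] says α = [a₀, …, aⱼ₋₁, θ], that is,
-- θ is the complete quotient αⱼ.  The last entry θ may be any real number.
infix 4 _≈[_⨾_]

data _≈[_⨾_] (α : ℝ) : List ℤ → ℝ → Set where
  last : ∀ {θ} → α ≈ θ → α ≈[ [] ⨾ θ ]
  step : ∀ {a as θ} β 1/β →
         β ≈[ as ⨾ θ ] → IsReciprocal β 1/β → α ≈ fromℤ a + 1/β →
         α ≈[ a ∷ as ⨾ θ ]

-- mat a b c d has rows (a b) and (c d).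
record Mat₂ : Set where
  constructor mat
  field
    e₁₁ e₁₂ e₂₁ e₂₂ : ℤ

infixl 7 _⊗_

_⊗_ : Mat₂ → Mat₂ → Mat₂
mat a b c d ⊗ mat a′ b′ c′ d′ =
  mat (a ℤ.* a′ ℤ.+ b ℤ.* c′) (a ℤ.* b′ ℤ.+ b ℤ.* d′)
      (c ℤ.* a′ ℤ.+ d ℤ.* c′) (c ℤ.* b′ ℤ.+ d ℤ.* d′)

cfMatrix : ∀ {h} → Vec ℤ h → Mat₂
cfMatrix []       = mat ℤ.1ℤ ℤ.0ℤ ℤ.0ℤ ℤ.1ℤ
cfMatrix (a ∷ as) = mat a ℤ.1ℤ ℤ.1ℤ ℤ.0ℤ ⊗ cfMatrix as

{-# OPTIONS --safe #-}
-- Unfolding the expansion gives β (q θ + q′) = p θ + p′ for β = [a₁, …, aₕ, θ].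
-- Inserting ω = A + 1/β and Q θ = ω + P yields a quadratic equation for ω over ℤ;
-- subtracting p times ω² − t ω + n leaves a linear one, both of whose
-- coefficients vanish since ω is irrational.
module Submission where

open import Defs
open import Data.Empty using (⊥-elim)
open import Data.Integer as ℤ using (ℤ; 0ℤ; 1ℤ)
import Data.Integer.Properties as ℤₚ
open import Data.Integer.Solver using () renaming (module +-*-Solver to ℤSolver)
open import Data.List using (_∷_)
open import Data.Nat as ℕ using (ℕ; _⊔_)
import Data.Nat.Properties as ℕₚ
open import Data.Product using (_×_; _,_; proj₁; proj₂; ∃-syntax)
open import Data.Rational as ℚ using (ℚ; 0ℚ; 1ℚ; ½)
import Data.Rational.Properties as ℚₚ
open import Data.Rational.Solver using () renaming (module +-*-Solver to ℚSolver)
open import Data.Vec using (Vec; []; _∷_; toList)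
open import Data.Vec.Relation.Unary.All using (All)
open import Relation.Binary.PropositionalEquality
  using (_≡_; refl; sym; trans; cong; cong₂; subst; module ≡-Reasoning)
open import Relation.Nullary using (yes; no)

-- Null sequences of rationals

-- x ≈ y is definitionally Null (λ n → seq x n ℚ.- seq y n).
Null : (ℕ → ℚ) → Set
Null x = ∀ ε → 0ℚ ℚ.< ε → ∃[ N ] (∀ n → N ℕ.≤ n → ℚ.∣ x n ∣ ℚ.< ε)

null-resp : ∀ {x y} → (∀ n → x n ≡ y n) → Null x → Null y
null-resp x≡y nx ε ε>0 =
  let N , hx = nx ε ε>0
  in N , λ n p → subst (λ d → ℚ.∣ d ∣ ℚ.< ε) (x≡y n) (hx n p)

null-+ : ∀ {x y} → Null x → Null y → Null (λ n → x n ℚ.+ y n)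
null-+ {x} {y} nx ny ε ε>0 =
  let M , hx = nx (ε ℚ.* ½) (half-pos ε>0)
      N , hy = ny (ε ℚ.* ½) (half-pos ε>0)
  in M ⊔ N , λ n p → begin-strict
    ℚ.∣ x n ℚ.+ y n ∣
      ≤⟨ ℚₚ.∣p+q∣≤∣p∣+∣q∣ (x n) (y n) ⟩
    ℚ.∣ x n ∣ ℚ.+ ℚ.∣ y n ∣
      <⟨ ℚₚ.+-mono-< (hx n (ℕₚ.m⊔n≤o⇒m≤o M N p)) (hy n (ℕₚ.m⊔n≤o⇒n≤o M N p)) ⟩
    ε ℚ.* ½ ℚ.+ ε ℚ.* ½
      ≡⟨ half+half ε ⟩
    ε ∎
  where open ℚₚ.≤-Reasoning

-- A Cauchy factor is eventually bounded. With `null-+` and `null-resp`, this turns every deduction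
-- about `≈` below into a combination of hypotheses with real coefficients plus one termwise
-- identity in ℚ.
null-* : ∀ (c : ℝ) {x} → Null x → Null (λ n → seq c n ℚ.* x n)
null-* c {x} nx ε ε>0 =
  let B , B>0 , M , hc = bounded {seq c} (cauchy c)
      δ , δ>0 , small = scale B ε B>0 ε>0
      N , hx = nx δ δ>0
  in M ⊔ N , λ n p → begin-strict
    ℚ.∣ seq c n ℚ.* x n ∣
      ≡⟨ ℚₚ.∣p*q∣≡∣p∣*∣q∣ (seq c n) (x n) ⟩
    ℚ.∣ seq c n ∣ ℚ.* ℚ.∣ x n ∣
      <⟨ small ℚ.∣ seq c n ∣ (x n) (hc n (ℕₚ.m⊔n≤o⇒m≤o M N p))
           (hx n (ℕₚ.m⊔n≤o⇒n≤o M N p)) ⟩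
    ε ∎
  where open ℚₚ.≤-Reasoning

-- For y ≠ 0 the choice ε = ∣y∣ would give ∣y∣ < ∣y∣.
null-const : ∀ {y} → Null (λ _ → y) → y ≡ 0ℚ
null-const {y} ny with y ℚ.≟ 0ℚ
... | yes y≡0 = y≡0
... | no y≢0 =
  let N , hy = ny ℚ.∣ y ∣ (ℚₚ.positive⁻¹ ℚ.∣ y ∣ {{ℚₚ.nonNeg∧nonZero⇒pos ℚ.∣ y ∣
                 {{ℚₚ.∣-∣-nonNeg y}} {{ℚ.≢-nonZero λ e → y≢0 (ℚₚ.∣p∣≡0⇒p≡0 y e)}}}})
  in ⊥-elim (ℚₚ.<-irrefl refl (hy N ℕₚ.≤-refl))

-- The coefficients are rational, so x = 0 is decidable. If x ≠ 0, multiplying by 1/x shows ω ≈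
-- -y/x, against irrationality; if x = 0, the null sequence is the constant y.
irrational⇒independent : ∀ {ω} → Irrational ω → ∀ x y →
  Null (λ n → x ℚ.* seq ω n ℚ.+ y) → x ≡ 0ℚ × y ≡ 0ℚ
irrational⇒independent {ω} irr x y nxy with x ℚ.≟ 0ℚ
... | yes refl = refl , null-const (null-resp drop nxy)
  where
  drop : ∀ n → 0ℚ ℚ.* seq ω n ℚ.+ y ≡ y
  drop n = trans (cong (ℚ._+ y) (ℚₚ.*-zeroˡ (seq ω n))) (ℚₚ.+-identityˡ y)
... | no x≢0 = ⊥-elim (irr (ℚ.- (i ℚ.* y)) (null-resp solved (null-* (fromℚ i) nxy)))
  where
  instance
    x-nonZero : ℚ.NonZero x
    x-nonZero = ℚ.≢-nonZero x≢0
  i : ℚ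
  i = ℚ.1/ x
  open ≡-Reasoning
  solved : ∀ n → i ℚ.* (x ℚ.* seq ω n ℚ.+ y) ≡ seq ω n ℚ.- ℚ.- (i ℚ.* y)
  solved n = begin
    i ℚ.* (x ℚ.* seq ω n ℚ.+ y)
      ≡⟨ (solve 4 (λ i x w y → i :* (x :* w :+ y) := (i :* x) :* w :- :- (i :* y))
            refl i x (seq ω n) y) ⟩
    (i ℚ.* x) ℚ.* seq ω n ℚ.- ℚ.- (i ℚ.* y)
      ≡⟨ cong (λ u → u ℚ.* seq ω n ℚ.- ℚ.- (i ℚ.* y)) (ℚₚ.*-inverseˡ x) ⟩
    1ℚ ℚ.* seq ω n ℚ.- ℚ.- (i ℚ.* y)
      ≡⟨ cong (ℚ._- ℚ.- (i ℚ.* y)) (ℚₚ.*-identityˡ (seq ω n)) ⟩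
    seq ω n ℚ.- ℚ.- (i ℚ.* y) ∎
    where open ℚSolver

-- The ring embedding of ℤ in ℚ

ℤ→ℚ-injective : ∀ {j k} → ℤ→ℚ j ≡ ℤ→ℚ k → j ≡ k
ℤ→ℚ-injective = cong ℚ.numerator

ℤ→ℚ-+ : ∀ j k → ℤ→ℚ (j ℤ.+ k) ≡ ℤ→ℚ j ℚ.+ ℤ→ℚ k
-- The sum on the right computes to `(j * 1 + k * 1) / 1`, so only the factors 1 have to be removed.
ℤ→ℚ-+ j k = trans (sym (ℚₚ.↥p/↧p≡p (ℤ→ℚ (j ℤ.+ k))))
  (cong (ℚ._/ 1) (sym (cong₂ ℤ._+_ (ℤₚ.*-identityʳ j) (ℤₚ.*-identityʳ k))))

ℤ→ℚ-* : ∀ j k → ℤ→ℚ (j ℤ.* k) ≡ ℤ→ℚ j ℚ.* ℤ→ℚ k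
ℤ→ℚ-* j k = sym (ℚₚ.↥p/↧p≡p (ℤ→ℚ (j ℤ.* k)))

ℤ→ℚ-neg : ∀ k → ℤ→ℚ (ℤ.- k) ≡ ℚ.- ℤ→ℚ k
ℤ→ℚ-neg (ℤ.+ 0)       = refl
ℤ→ℚ-neg (ℤ.+ ℕ.suc _) = refl
ℤ→ℚ-neg (ℤ.-[1+ _ ])  = refl

ℤ→ℚ-- : ∀ j k → ℤ→ℚ (j ℤ.- k) ≡ ℤ→ℚ j ℚ.- ℤ→ℚ k
ℤ→ℚ-- j k = trans (ℤ→ℚ-+ j (ℤ.- k)) (cong (ℤ→ℚ j ℚ.+_) (ℤ→ℚ-neg k))

-- Continued fractions as Möbius maps

-- The Möbius relation β = (p θ + p′) / (q θ + q′), cleared of its denominator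
-- so that no apartness from zero is needed.
cf-möbius : ∀ {h} (a : Vec ℤ h) {β θ} → β ≈[ toList a ⨾ θ ] →
  ∀ {p p′ q q′} → cfMatrix a ≡ mat p p′ q q′ →
  β * (fromℤ q * θ + fromℤ q′) ≈ fromℤ p * θ + fromℤ p′
cf-möbius [] {β} {θ} (last β≈θ) refl =
  null-resp (λ n → identity (seq β n) (seq θ n)) β≈θ
  where
  open ℚSolver
  identity : ∀ b θ → b ℚ.- θ ≡ b ℚ.* (0ℚ ℚ.* θ ℚ.+ 1ℚ) ℚ.- (1ℚ ℚ.* θ ℚ.+ 0ℚ)
  identity = solve 2
    (λ b θ → b :- θ := b :* (con 0ℚ :* θ :+ con 1ℚ) :- (con 1ℚ :* θ :+ con 0ℚ)) refl
cf-möbius (a ∷ as) {α} {θ} (step β r β≈ βr≈1 α≈a+r) refl =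
  -- With K = q θ + q′ and L = p θ + p′ for the tail, L (α - (a + r)) + K (β r - 1) - r (β K - L)
  -- equals α L - (a L + K): all terms in r cancel. This is the relation for the matrix with rows (a
  -- p + q, a p′ + q′) and (p, p′).
  null-resp identity
    (null-+ (null-* (fromℤ p * θ + fromℤ p′) α≈a+r)
      (null-+ (null-* (fromℤ q * θ + fromℤ q′) βr≈1)
        (null-* (fromℤ 0ℤ - r) (cf-möbius as {β} {θ} β≈ refl))))
  where
  -- From here on `p`, `p′`, `q`, `q′` belong to the tail; the entries for `a ∷ as` appear as the
  -- unreduced sums of the matrix product.
  open Mat₂ (cfMatrix as) renaming (e₁₁ to p; e₁₂ to p′; e₂₁ to q; e₂₂ to q′)

  ℤ→ℚ-a*j+1*k : ∀ j k → ℤ→ℚ (a ℤ.* j ℤ.+ 1ℤ ℤ.* k) ≡ ℤ→ℚ a ℚ.* ℤ→ℚ j ℚ.+ ℤ→ℚ k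
  ℤ→ℚ-a*j+1*k j k = trans (ℤ→ℚ-+ (a ℤ.* j) (1ℤ ℤ.* k))
    (cong₂ ℚ._+_ (ℤ→ℚ-* a j) (cong ℤ→ℚ (ℤₚ.*-identityˡ k)))

  ℤ→ℚ-1*j+0*k : ∀ j k → ℤ→ℚ (1ℤ ℤ.* j ℤ.+ 0ℤ ℤ.* k) ≡ ℤ→ℚ j
  ℤ→ℚ-1*j+0*k j k = cong ℤ→ℚ (trans (ℤₚ.+-identityʳ (1ℤ ℤ.* j)) (ℤₚ.*-identityˡ j))

  identity : ∀ n →
    (ℤ→ℚ p ℚ.* seq θ n ℚ.+ ℤ→ℚ p′) ℚ.* (seq α n ℚ.- (ℤ→ℚ a ℚ.+ seq r n))
      ℚ.+ ((ℤ→ℚ q ℚ.* seq θ n ℚ.+ ℤ→ℚ q′) ℚ.* (seq β n ℚ.* seq r n ℚ.- 1ℚ)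
      ℚ.+ (0ℚ ℚ.- seq r n) ℚ.*
        (seq β n ℚ.* (ℤ→ℚ q ℚ.* seq θ n ℚ.+ ℤ→ℚ q′)
          ℚ.- (ℤ→ℚ p ℚ.* seq θ n ℚ.+ ℤ→ℚ p′)))
    ≡ seq α n ℚ.* (ℤ→ℚ (1ℤ ℤ.* p ℤ.+ 0ℤ ℤ.* q) ℚ.* seq θ n
                     ℚ.+ ℤ→ℚ (1ℤ ℤ.* p′ ℤ.+ 0ℤ ℤ.* q′))
      ℚ.- (ℤ→ℚ (a ℤ.* p ℤ.+ 1ℤ ℤ.* q) ℚ.* seq θ n
             ℚ.+ ℤ→ℚ (a ℤ.* p′ ℤ.+ 1ℤ ℤ.* q′))
  identity n = trans
    (combination (ℤ→ℚ a) (seq r n) (seq β n) (seq α n) (seq θ n)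
      (ℤ→ℚ p) (ℤ→ℚ p′) (ℤ→ℚ q) (ℤ→ℚ q′))
    (sym (cong₂ ℚ._-_
      (cong (seq α n ℚ.*_) (linear (ℤ→ℚ-1*j+0*k p q) (ℤ→ℚ-1*j+0*k p′ q′)))
      (linear (ℤ→ℚ-a*j+1*k p q) (ℤ→ℚ-a*j+1*k p′ q′))))
    where
    linear : ∀ {x y u v} → x ≡ u → y ≡ v → x ℚ.* seq θ n ℚ.+ y ≡ u ℚ.* seq θ n ℚ.+ v
    linear = cong₂ λ x y → x ℚ.* seq θ n ℚ.+ y
    open ℚSolver
    combination : ∀ a r b w θ p p′ q q′ →
      (p ℚ.* θ ℚ.+ p′) ℚ.* (w ℚ.- (a ℚ.+ r))
        ℚ.+ ((q ℚ.* θ ℚ.+ q′) ℚ.* (b ℚ.* r ℚ.- 1ℚ)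
        ℚ.+ (0ℚ ℚ.- r) ℚ.* (b ℚ.* (q ℚ.* θ ℚ.+ q′) ℚ.- (p ℚ.* θ ℚ.+ p′)))
      ≡ w ℚ.* (p ℚ.* θ ℚ.+ p′) ℚ.- ((a ℚ.* p ℚ.+ q) ℚ.* θ ℚ.+ (a ℚ.* p′ ℚ.+ q′))
    combination = solve 9 (λ a r b w θ p p′ q q′ →
      (p :* θ :+ p′) :* (w :- (a :+ r))
        :+ ((q :* θ :+ q′) :* (b :* r :- con 1ℚ)
        :+ (con 0ℚ :- r) :* (b :* (q :* θ :+ q′) :- (p :* θ :+ p′)))
      := w :* (p :* θ :+ p′) :- ((a :* p :+ q) :* θ :+ (a :* p′ :+ q′))) refl

theorem2 : ∀ (t n : ℤ) (ω : ℝ) →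
    Irrational ω →
    ω * ω - fromℤ t * ω + fromℤ n ≈ fromℤ 0ℤ →
    ∀ (h : ℕ) → 1 ℕ.≤ h →
    ∀ (A : ℤ) (a : Vec ℤ h) → All (0ℤ ℤ.<_) a →
    ∀ (P Q : ℤ) .{{_ : ℤ.NonZero Q}} →
    ω ≈[ A ∷ toList a ⨾ (ω + fromℤ P) ÷ Q ] →
    ∀ (p p′ q q′ : ℤ) → cfMatrix a ≡ mat p p′ q q′ →
    (p ℤ.* (P ℤ.* P ℤ.+ t ℤ.* P ℤ.+ n) ℤ.+ p′ ℤ.* Q ℤ.* (A ℤ.+ P) ≡ ℤ.- (q′ ℤ.* Q))
    ×
    (p ℤ.* (A ℤ.* A ℤ.- t ℤ.* A ℤ.+ n) ℤ.+ q ℤ.* (A ℤ.+ P) ≡ ℤ.- (q′ ℤ.* Q))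
theorem2 t n ω irr ω-root h 1≤h A a a>0 P Q (step β r β≈ βr≈1 ω≈A+r) p p′ q q′ M≡ =
  first , second
  where
  θ : ℝ
  θ = (ω + fromℤ P) ÷ Q
  K L : ℝ
  K = fromℤ q * θ + fromℤ q′
  L = fromℤ p * θ + fromℤ p′
  -- The coefficients in (ω - A)(p (ω + P) + p′ Q) - (q (ω + P) + q′ Q) - p (ω² - t ω + n) = X ω +
  -- Y, where the terms in ω² cancel.
  X Y : ℤ
  X = p ℤ.* (t ℤ.+ P ℤ.- A) ℤ.+ p′ ℤ.* Q ℤ.- q
  Y = ℤ.- (p ℤ.* n ℤ.+ A ℤ.* (p ℤ.* P ℤ.+ p′ ℤ.* Q) ℤ.+ q ℤ.* P ℤ.+ q′ ℤ.* Q)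

  -- These follow the shape of an integer expression and push the embedding down to its variables,
  -- where the ring solver over ℚ can treat the images as atoms.
  cast-+ : ∀ {j k x y} → ℤ→ℚ j ≡ x → ℤ→ℚ k ≡ y → ℤ→ℚ (j ℤ.+ k) ≡ x ℚ.+ y
  cast-+ {j} {k} j≡x k≡y = trans (ℤ→ℚ-+ j k) (cong₂ ℚ._+_ j≡x k≡y)
  cast-- : ∀ {j k x y} → ℤ→ℚ j ≡ x → ℤ→ℚ k ≡ y → ℤ→ℚ (j ℤ.- k) ≡ x ℚ.- y
  cast-- {j} {k} j≡x k≡y = trans (ℤ→ℚ-- j k) (cong₂ ℚ._-_ j≡x k≡y)
  cast-* : ∀ {j k x y} → ℤ→ℚ j ≡ x → ℤ→ℚ k ≡ y → ℤ→ℚ (j ℤ.* k) ≡ x ℚ.* y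
  cast-* {j} {k} j≡x k≡y = trans (ℤ→ℚ-* j k) (cong₂ ℚ._*_ j≡x k≡y)
  cast-neg : ∀ {j x} → ℤ→ℚ j ≡ x → ℤ→ℚ (ℤ.- j) ≡ ℚ.- x
  cast-neg {j} j≡x = trans (ℤ→ℚ-neg j) (cong ℚ.-_ j≡x)

  castX : ℤ→ℚ X ≡
    ℤ→ℚ p ℚ.* (ℤ→ℚ t ℚ.+ ℤ→ℚ P ℚ.- ℤ→ℚ A) ℚ.+ ℤ→ℚ p′ ℚ.* ℤ→ℚ Q ℚ.- ℤ→ℚ q
  castX = cast--
    (cast-+ (cast-* {p} refl (cast-- (ℤ→ℚ-+ t P) refl)) (ℤ→ℚ-* p′ Q)) refl

  castY : ℤ→ℚ Y ≡
    ℚ.- (ℤ→ℚ p ℚ.* ℤ→ℚ n ℚ.+ ℤ→ℚ A ℚ.* (ℤ→ℚ p ℚ.* ℤ→ℚ P ℚ.+ ℤ→ℚ p′ ℚ.* ℤ→ℚ Q)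
         ℚ.+ ℤ→ℚ q ℚ.* ℤ→ℚ P ℚ.+ ℤ→ℚ q′ ℚ.* ℤ→ℚ Q)
  castY = cast-neg
    (cast-+ (cast-+ (cast-+ (ℤ→ℚ-* p n)
        (cast-* {A} refl (cast-+ (ℤ→ℚ-* p P) (ℤ→ℚ-* p′ Q))))
      (ℤ→ℚ-* q P)) (ℤ→ℚ-* q′ Q))

  Qθ≡ω+P : ∀ k → ℤ→ℚ Q ℚ.* seq θ k ≡ seq ω k ℚ.+ ℤ→ℚ P
  Qθ≡ω+P k = begin
    Q₁ ℚ.* (s ℚ.* ℚ.1/ Q₁)  ≡⟨ ℚₚ.*-comm Q₁ (s ℚ.* ℚ.1/ Q₁) ⟩
    (s ℚ.* ℚ.1/ Q₁) ℚ.* Q₁  ≡⟨ ℚₚ.*-assoc s (ℚ.1/ Q₁) Q₁ ⟩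
    s ℚ.* (ℚ.1/ Q₁ ℚ.* Q₁)  ≡⟨ cong (s ℚ.*_) (ℚₚ.*-inverseˡ Q₁) ⟩
    s ℚ.* 1ℚ                ≡⟨ ℚₚ.*-identityʳ s ⟩
    s                       ∎
    where
    open ≡-Reasoning
    Q₁ s : ℚ
    Q₁ = ℤ→ℚ Q
    s  = seq ω k ℚ.+ ℤ→ℚ P

  -- The coefficients of the hypotheses come from
  -- (ω − A) L − K = L (ω − (A + r)) + K (β r − 1) − r (β K − L),
  -- multiplied by Q, and minus p times the quadratic equation.
  Xω+Y-null : Null (λ k → ℤ→ℚ X ℚ.* seq ω k ℚ.+ ℤ→ℚ Y)
  Xω+Y-null = null-resp
    (λ k → trans
      (combination (ℤ→ℚ t) (ℤ→ℚ n) (ℤ→ℚ A) (ℤ→ℚ P) (ℤ→ℚ Q) (ℤ→ℚ p) (ℤ→ℚ p′)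
        (ℤ→ℚ q) (ℤ→ℚ q′) (seq ω k) (seq β k) (seq r k) (seq θ k) (Qθ≡ω+P k))
      (sym (cong₂ (λ x y → x ℚ.* seq ω k ℚ.+ y) castX castY)))
    (null-+
      (null-* (fromℤ Q)
        (null-+ (null-* L ω≈A+r)
          (null-+ (null-* K βr≈1)
            (null-* (fromℤ 0ℤ - r) (cf-möbius a {β} {θ} β≈ M≡)))))
      (null-* (fromℤ 0ℤ - fromℤ p) ω-root))
    where
    combination : ∀ t n A P Q p p′ q q′ w b r θ → Q ℚ.* θ ≡ w ℚ.+ P →
      Q ℚ.* ((p ℚ.* θ ℚ.+ p′) ℚ.* (w ℚ.- (A ℚ.+ r))
        ℚ.+ ((q ℚ.* θ ℚ.+ q′) ℚ.* (b ℚ.* r ℚ.- 1ℚ)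
        ℚ.+ (0ℚ ℚ.- r) ℚ.* (b ℚ.* (q ℚ.* θ ℚ.+ q′) ℚ.- (p ℚ.* θ ℚ.+ p′))))
      ℚ.+ (0ℚ ℚ.- p) ℚ.* ((w ℚ.* w ℚ.- t ℚ.* w ℚ.+ n) ℚ.- 0ℚ)
      ≡ (p ℚ.* (t ℚ.+ P ℚ.- A) ℚ.+ p′ ℚ.* Q ℚ.- q) ℚ.* w
        ℚ.+ ℚ.- (p ℚ.* n ℚ.+ A ℚ.* (p ℚ.* P ℚ.+ p′ ℚ.* Q) ℚ.+ q ℚ.* P ℚ.+ q′ ℚ.* Q)
    combination t n A P Q p p′ q q′ w b r θ Qθ≡w+P = begin
      -- The terms in `b` and `r` cancel as polynomials, and θ survives only in the product `Q * θ`,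
      -- which is kept intact for the rewriting that follows.
      _ ≡⟨ (solve 12 (λ t n A Q p p′ q q′ w b r θ →
             Q :* ((p :* θ :+ p′) :* (w :- (A :+ r))
               :+ ((q :* θ :+ q′) :* (b :* r :- con 1ℚ)
               :+ (con 0ℚ :- r) :* (b :* (q :* θ :+ q′) :- (p :* θ :+ p′))))
             :+ (con 0ℚ :- p) :* ((w :* w :- t :* w :+ n) :- con 0ℚ)
             := (w :- A) :* (p :* (Q :* θ) :+ p′ :* Q) :- (q :* (Q :* θ) :+ q′ :* Q)
               :- p :* (w :* w :- t :* w :+ n))
             refl t n A Q p p′ q q′ w b r θ) ⟩
      (w ℚ.- A) ℚ.* (p ℚ.* (Q ℚ.* θ) ℚ.+ p′ ℚ.* Q) ℚ.- (q ℚ.* (Q ℚ.* θ) ℚ.+ q′ ℚ.* Q)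
        ℚ.- p ℚ.* (w ℚ.* w ℚ.- t ℚ.* w ℚ.+ n)
        ≡⟨ cong (λ s → (w ℚ.- A) ℚ.* (p ℚ.* s ℚ.+ p′ ℚ.* Q) ℚ.- (q ℚ.* s ℚ.+ q′ ℚ.* Q)
                         ℚ.- p ℚ.* (w ℚ.* w ℚ.- t ℚ.* w ℚ.+ n)) Qθ≡w+P ⟩
      (w ℚ.- A) ℚ.* (p ℚ.* (w ℚ.+ P) ℚ.+ p′ ℚ.* Q) ℚ.- (q ℚ.* (w ℚ.+ P) ℚ.+ q′ ℚ.* Q)
        ℚ.- p ℚ.* (w ℚ.* w ℚ.- t ℚ.* w ℚ.+ n)
        -- Now θ is gone, and the two terms p w² cancel.
        ≡⟨ (solve 10 (λ t n A P Q p p′ q q′ w →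
             (w :- A) :* (p :* (w :+ P) :+ p′ :* Q) :- (q :* (w :+ P) :+ q′ :* Q)
               :- p :* (w :* w :- t :* w :+ n)
             := (p :* (t :+ P :- A) :+ p′ :* Q :- q) :* w
               :+ :- (p :* n :+ A :* (p :* P :+ p′ :* Q) :+ q :* P :+ q′ :* Q))
             refl t n A P Q p p′ q q′ w) ⟩
      _ ∎
      where
      open ≡-Reasoning
      open ℚSolver

  X≡0 : X ≡ 0ℤ
  X≡0 = ℤ→ℚ-injective (proj₁ (irrational⇒independent {ω} irr (ℤ→ℚ X) (ℤ→ℚ Y) Xω+Y-null))
  Y≡0 : Y ≡ 0ℤ
  Y≡0 = ℤ→ℚ-injective (proj₂ (irrational⇒independent {ω} irr (ℤ→ℚ X) (ℤ→ℚ Y) Xω+Y-null))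

  open ≡-Reasoning
  open ℤSolver

  -- This is X ω + Y = 0 with -P put for ω: the factor ω + P vanishes and the quadratic becomes P² +
  -- t P + n.
  first : p ℤ.* (P ℤ.* P ℤ.+ t ℤ.* P ℤ.+ n) ℤ.+ p′ ℤ.* Q ℤ.* (A ℤ.+ P) ≡ ℤ.- (q′ ℤ.* Q)
  first = begin
    p ℤ.* (P ℤ.* P ℤ.+ t ℤ.* P ℤ.+ n) ℤ.+ p′ ℤ.* Q ℤ.* (A ℤ.+ P)
      ≡⟨ (solve 9 (λ t n A P Q p p′ q q′ →
           p :* (P :* P :+ t :* P :+ n) :+ p′ :* Q :* (A :+ P)
           := (p :* (t :+ P :- A) :+ p′ :* Q :- q) :* P
             :- :- (p :* n :+ A :* (p :* P :+ p′ :* Q) :+ q :* P :+ q′ :* Q) :- q′ :* Q)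
           refl t n A P Q p p′ q q′) ⟩
    X ℤ.* P ℤ.- Y ℤ.- q′ ℤ.* Q
      ≡⟨ cong₂ (λ x y → x ℤ.* P ℤ.- y ℤ.- q′ ℤ.* Q) X≡0 Y≡0 ⟩
    0ℤ ℤ.* P ℤ.- 0ℤ ℤ.- q′ ℤ.* Q
      ≡⟨ ℤₚ.+-identityˡ (ℤ.- (q′ ℤ.* Q)) ⟩
    ℤ.- (q′ ℤ.* Q) ∎

  -- Here A is put for ω instead: the factor ω - A vanishes, which removes p′, and the quadratic
  -- becomes A² - t A + n.
  second : p ℤ.* (A ℤ.* A ℤ.- t ℤ.* A ℤ.+ n) ℤ.+ q ℤ.* (A ℤ.+ P) ≡ ℤ.- (q′ ℤ.* Q)
  second = begin
    p ℤ.* (A ℤ.* A ℤ.- t ℤ.* A ℤ.+ n) ℤ.+ q ℤ.* (A ℤ.+ P)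
      ≡⟨ (solve 9 (λ t n A P Q p p′ q q′ →
           p :* (A :* A :- t :* A :+ n) :+ q :* (A :+ P)
           := con 0ℤ :- (p :* (t :+ P :- A) :+ p′ :* Q :- q) :* A
             :- :- (p :* n :+ A :* (p :* P :+ p′ :* Q) :+ q :* P :+ q′ :* Q) :- q′ :* Q)
           refl t n A P Q p p′ q q′) ⟩
    0ℤ ℤ.- X ℤ.* A ℤ.- Y ℤ.- q′ ℤ.* Q
      ≡⟨ cong₂ (λ x y → 0ℤ ℤ.- x ℤ.* A ℤ.- y ℤ.- q′ ℤ.* Q) X≡0 Y≡0 ⟩
    0ℤ ℤ.- 0ℤ ℤ.* A ℤ.- 0ℤ ℤ.- q′ ℤ.* Q
      ≡⟨ ℤₚ.+-identityˡ (ℤ.- (q′ ℤ.* Q)) ⟩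
    ℤ.- (q′ ℤ.* Q) ∎
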